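{- Let $F$ be a correlation-free cellular automaton (CFCA). If $\mathcal{S}_F^t$ is number-conserving and surjective for some $t>0$, then $F$ is deterministic.
   Context: A (one-dimensional) stochastic cellular automaton is a tuple $(Q,R,V,V',f)$ where $Q$ (states) and $R$ (random symbols) are finite sets, $V=\{v_1,\dots,v_\rho\}$ and $V'=\{v'_1,\dots,v'_{\rho'}\}$ are finite subsets of $\mathbb{Z}$, and $f:Q^\rho\times R^{\rho'}\to Q$. It is a CFCA if $V'=\{0\}$. It is identified with its explicit global function $F:Q^{\mathbb{Z}}\times R^{\mathbb{Z}}\to Q^{\mathbb{Z}}$, $F(c,s)_z=f\big((c_{z+v_j})_j,(s_{z+v'_j})_j\big)$. Iterates: $F^0(c)=c$, $F^{t+1}(c,s^1,\dots,s^{t+1})=F(F^t(c,s^1,\dots,s^t),s^{t+1})$. $\mathcal{S}_F^t(c)$ is the law of $F^t(c,s^1,\dots,s^t)$ when $s^1,\dots,s^t$ are independent and each drawn from the uniform (i.i.d. uniform product) measure on $R^{\mathbb{Z}}$. $F$ is deterministic if $f$ does not depend on its second argument (the random symbols). A configuration is finite if it has finitely many cells in a state other than $0$. $\mathcal{S}_F^t$ is number-conserving if $Q=\{0,\dots,q\}$ for some $q\in\mathbb{N}$ and for every finite configuration $c\in Q^{\mathbb{Z}}$, $\big(\mathcal{S}_F^t(c)\big)(\{c':\sum_i c'_i=\sum_i c_i\})=1$, where the sums range over $\mathbb{Z}$ and only finite configurations $c'$ are considered. $\mathcal{S}_F^t$ is surjective if for every $c\in Q^{\mathbb{Z}}$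 there are $c'\in Q^{\mathbb{Z}}$ and $s^1,\dots,s^t\in R^{\mathbb{Z}}$ with $F^t(c',s^1,\dots,s^t)=c$. -}

module Defs where

open import Data.Fin.Base using (Fin; toℕ)
open import Data.Integer.Base as ℤ using (ℤ; 0ℤ)
open import Data.List.Base as List using (List; []; _∷_; length)
open import Data.List.Membership.Propositional using (_∈_)
open import Data.List.Relation.Unary.All using (All)
open import Data.List.Relation.Unary.Unique.Propositional using (Unique)
open import Data.Maybe.Base using (Maybe; just; nothing)
open import Data.Maybe.Relation.Unary.Any as Maybe using ()
open import Data.Nat.Base as ℕ using (ℕ; zero; suc; NonZero)
open import Data.Nat.ListAction using (sum)
open import Data.Nat.Properties using (m^n≢0)
open import Data.Product.Base using (_×_; _,_; proj₁; Σ-syntax; ∃-syntax)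
open import Data.Rational.Base as ℚ using (ℚ; 0ℚ; 1ℚ)
open import Data.Vec.Base as Vec using (Vec)
open import Data.Vec.Functional using (Vector; init; last)
open import Level using (0ℓ)
open import Relation.Binary.PropositionalEquality using (_≡_; _≢_; _≗_)
open import Relation.Unary using (Pred; ∁)

-- The finite sets of states and of random symbols are taken to be
-- {0,…,∣Q∣-1} and {0,…,∣R∣-1}.  The uniform measure on R^ℤ requires R ≠ ∅.
-- Neighbourhoods are enumerated without repetition, the order fixing the
-- order of the arguments of f.

record SCA : Set where
  field
    ∣Q∣ ∣R∣   : ℕ
    {{R≢∅}}   : NonZero ∣R∣
    V V′      : List ℤ
    V-unique  : Unique V
    V′-unique : Unique V′

    f         : Vec (Fin ∣Q∣) (length V) → Vec (Fin ∣R∣) (length V′) → Fin ∣Q∣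

  Q R : Set
  Q = Fin ∣Q∣
  R = Fin ∣R∣

  Config : Set
  Config = ℤ → Q

  global : Config → (ℤ → R) → Config
  global c s z = f (Vec.map (λ v → c (z ℤ.+ v)) (Vec.fromList V))
                   (Vec.map (λ v → s (z ℤ.+ v)) (Vec.fromList V′))

  iterate : (t : ℕ) → Config → Vector (ℤ → R) t → Config
  iterate zero    c s = c
  iterate (suc t) c s = global (iterate t c (init s)) (last s)

open SCA using (∣Q∣; ∣R∣; R≢∅; V′; f; Config; iterate)

CFCA : SCA → Set
CFCA F = V′ F ≡ 0ℤ ∷ []

Deterministic : SCA → Set
Deterministic F = ∀ a b b′ → f F a b ≡ f F a b′

Surjective : SCA → ℕ → Set
Surjective F t =
  ∀ (c : Config F) → ∃[ c′ ] ∃[ s ] iterate F t c′ s ≗ c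

-- The product of t copies of the uniform (i.i.d. product) measure on S^ℤ,
-- S = {0,…,m-1}: the law of t independent uniform draws from S^ℤ.

module UniformMeasure (m : ℕ) {{_ : NonZero m}} (t : ℕ) where

  Ω : Set
  Ω = Vector (ℤ → Fin m) t

  Site : Set
  Site = Fin t × ℤ

  record Cylinder : Set where
    field
      constraints : List (Site × Fin m)
      distinct    : Unique (List.map proj₁ constraints)

  _∈ᶜ_ : Ω → Cylinder → Set
  ω ∈ᶜ C = All (λ { ((i , z) , r) → ω i z ≡ r }) (Cylinder.constraints C)

  cylinderVolume : Cylinder → ℚ
  cylinderVolume C = (ℤ.+ 1 ℚ./ (m ℕ.^ k)) {{m^n≢0 m k}}
    where k = length (Cylinder.constraints C)

  -- `nothing` is the empty set; it is needed in covers because for m = 1 every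
  -- cylinder has volume 1.
  volume : Maybe Cylinder → ℚ
  volume nothing  = 0ℚ
  volume (just C) = cylinderVolume C

  volumeBelow : (ℕ → Maybe Cylinder) → ℕ → ℚ
  volumeBelow C zero    = 0ℚ
  volumeBelow C (suc n) = volumeBelow C n ℚ.+ volume (C n)

  record Cover (A : Pred Ω 0ℓ) (bound : ℚ) : Set where
    field
      cylinders : ℕ → Maybe Cylinder
      covers    : ∀ ω → A ω → ∃[ n ] Maybe.Any (ω ∈ᶜ_) (cylinders n)
      bounded   : ∀ n → volumeBelow cylinders n ℚ.≤ bound
      -- The series of volumes converges.  Classically this follows from
      -- `bounded`; constructively a cover with merely bounded partial sums may
      -- be degenerate (it need not leave any point uncovered even when
      -- bound < 1), so the modulus is part of the notion, as in Bishop's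
      -- measure theory.
      converges : ∀ δ → 0ℚ ℚ.< δ → ∃[ N ] ∀ k →
                  volumeBelow cylinders (N ℕ.+ k) ℚ.≤ volumeBelow cylinders N ℚ.+ δ

  OuterMeasure≤ : Pred Ω 0ℓ → ℚ → Set
  OuterMeasure≤ A p = ∀ ε → 0ℚ ℚ.< ε → Cover A (p ℚ.+ ε)

  -- Lebesgue's definition of measurability in a probability space, for a
  -- rational value p: since μ*(A) + μ*(∁ A) ≥ 1, these two bounds say exactly
  -- that A is measurable (for the completed measure) with μ(A) = p.
  HasMeasure : Pred Ω 0ℓ → ℚ → Set
  HasMeasure A p = OuterMeasure≤ A p × OuterMeasure≤ (∁ A) (1ℚ ℚ.- p)

-- Law F t c B p: the law of iterate F t c under t independent uniform draws
-- gives the event B probability p.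

Law : (F : SCA) (t : ℕ) → Config F → Pred (Config F) 0ℓ → ℚ → Set
Law F t c B = HasMeasure (λ s → B (iterate F t c s))
  where open UniformMeasure (∣R∣ F) {{R≢∅ F}} t

record Finite (F : SCA) (c : Config F) : Set where
  field
    cells    : List ℤ
    unique   : Unique cells
    complete : ∀ z → toℕ (c z) ≢ 0 → z ∈ cells

-- Σ_{i ∈ ℤ} c_i; cells outside the list contribute 0, and cells inside it may
-- be in state 0, so the value does not depend on the chosen list.
total : (F : SCA) {c : Config F} → Finite F c → ℕ
total F {c} fin = sum (List.map (λ z → toℕ (c z)) (Finite.cells fin))

NumberConserving : SCA → ℕ → Set
NumberConserving F t =
  (∃[ q ] ∣Q∣ F ≡ suc q) ×
  (∀ (c : Config F) (fin : Finite F c) →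
     Law F t c (λ c′ → Σ[ fin′ ∈ Finite F c′ ] total F fin′ ≡ total F fin) 1ℚ)

module Submission where

-- Suppose F^(t+1) is number-conserving and surjective, and let a be a neighbourhood
-- pattern and b, b′ two tuples of random symbols.  Since F^(t+1) is surjective, so is
-- F^t, and as F^t at finitely many cells depends on finitely many data, there are a
-- finite configuration c and a cylinder of random symbols for the first t steps from
-- which a appears around cell 0 at time t (pattern-reachable).  In a CFCA the symbol
-- u used by cell 0 in the last step influences the state of cell 0 at time t+1 and
-- nothing else (outcome-elsewhere).  Suppose that some choice of all the other random
-- symbols in the cylinder makes the outcome conserve the sum both for the symbol of b
-- and for the symbol of b′.  Then the two outcomes have the same sum and agree off
-- cell 0, so they agree at cell 0 (total-determines), where they are f a b and f a b′.
--
-- Such a choice exists because the random symbols violating conservation form a null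
-- set, and null sets can be avoided in this way (null-avoidable).  Indeed, cover the
-- null set by cylinders of very small total volume.
-- Dropping the constraints at the site x₀ of the symbol u, and conditioning on finitely
-- many prescribed symbols, increases the total volume by a bounded factor only, so it
-- may be assumed to stay below 1.  The remaining symbols are then decided one at a time
-- so that the total conditional volume stays below 1 (decide).  No cylinder of the cover
-- can contain the resulting point, since its conditional volume would eventually be 1.
-- The choices are computable thanks to the modulus of convergence of the cover.  The
-- point lies in the complement of the violating set in the sense of double negation,
-- which suffices because equality of states is decidable.

open import Defs
open import Algebra.Bundles using (CommutativeRing)
import Algebra.Properties.Semiring.Sum as Sum
open import Data.Bool.Base using (if_then_else_)
open import Data.Fin.Base as Fin using (Fin; inject₁; fromℕ; toℕ)
import Data.Fin.Properties as Fin
open import Data.Integer.Base as ℤ using (ℤ; 0ℤ)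
import Data.Integer.Properties as ℤ
open import Data.List.Base as List
  using (List; []; _∷_; _++_; length; filter; deduplicate; cartesianProductWith)
import Data.List.Membership.DecPropositional as DecMembership
open import Data.List.Membership.Propositional using (_∈_)
open import Data.List.Membership.Propositional.Properties
  using (∈-map⁺; ∈-++⁺ˡ; ∈-++⁺ʳ; ∈-filter⁺; ∈-filter⁻; ∈-deduplicate⁺; ∈-allFin;
         ∈-cartesianProduct⁺; ∈-cartesianProductWith⁺)
open import Data.List.Membership.Propositional.Properties.WithK using (unique∧set⇒bag)
open import Data.List.Properties using (filter-accept; filter-reject)
open import Data.List.Relation.Binary.BagAndSetEquality using (∼bag⇒↭)
open import Data.List.Relation.Binary.Permutation.Propositional.Properties using (map⁺)
open import Data.List.Relation.Unary.All as All using (All; []; _∷_)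
open import Data.List.Relation.Unary.AllPairs using ([]; _∷_)
open import Data.List.Relation.Unary.Any using (here; there)
open import Data.List.Relation.Unary.Unique.DecPropositional.Properties ℤ._≟_ using (deduplicate-!)
open import Data.List.Relation.Unary.Unique.Propositional using (Unique)
import Data.List.Relation.Unary.Unique.Propositional.Properties as Unique
open import Data.Maybe.Base using (Maybe; just; nothing)
open import Data.Maybe.Properties using (just-injective)
import Data.Maybe.Relation.Unary.Any as Maybe
open import Data.Nat.Base as ℕ using (ℕ; zero; suc; NonZero; _<_)
open import Data.Nat.ListAction using () renaming (sum to sumᴺ)
open import Data.Nat.ListAction.Properties using (sum-↭)
import Data.Nat.Properties as ℕ
open import Data.Product.Base
  using (_×_; _,_; proj₁; proj₂; Σ-syntax; ∃-syntax; uncurry; curry; map₁)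
open import Data.Product.Properties using (≡-dec)
open import Data.Rational.Base as ℚ using (ℚ; 0ℚ; 1ℚ; ½; *<*; _+_; _*_; _-_; _≤_)
open import Data.Rational.Properties
open import Data.Rational.Solver using (module +-*-Solver)
import Data.Rational.Unnormalised.Base as ℚᵘ
import Data.Rational.Unnormalised.Properties as ℚᵘ
open import Data.Sum.Base using (_⊎_; inj₁; inj₂)
open import Data.Vec.Base as Vec using (Vec; []; _∷_)
open import Data.Vec.Functional using (Vector; init; last; head; tail)
open import Function.Base using (_∘_; const)
open import Function.Bundles using (mk⇔)
open import Level using (0ℓ)
open import Relation.Binary.Definitions using (DecidableEquality)
open import Relation.Binary.PropositionalEquality
open import Relation.Nullary using (¬_; Dec; yes; no; ¬?; does; contradiction; decidable-stable)
open import Relation.Unary using (Pred)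

open Sum (CommutativeRing.semiring +-*-commutativeRing)
  using (sum; sum-cong-≗; *-distribˡ-sum; *-distribʳ-sum; ∑-distrib-+; sum-replicate-zero)

-- Rational arithmetic and series

/-toℚᵘ : ∀ i n .{{_ : NonZero n}} → ℚ.toℚᵘ (i ℚ./ n) ℚᵘ.≃ i ℚᵘ./ n
/-toℚᵘ i (suc n) = toℚᵘ-fromℚᵘ (i ℚᵘ./ suc n)

/-* : ∀ i j a b .{{_ : NonZero a}} .{{_ : NonZero b}} .{{_ : NonZero (a ℕ.* b)}} →
      (i ℚ./ a) * (j ℚ./ b) ≡ (i ℤ.* j) ℚ./ (a ℕ.* b)
/-* i j a@(suc _) b@(suc _) = toℚᵘ-injective (begin
  ℚ.toℚᵘ ((i ℚ./ a) * (j ℚ./ b))            ≈⟨ toℚᵘ-homo-* (i ℚ./ a) (j ℚ./ b) ⟩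
  ℚ.toℚᵘ (i ℚ./ a) ℚᵘ.* ℚ.toℚᵘ (j ℚ./ b)    ≈⟨ ℚᵘ.*-cong (/-toℚᵘ i a) (/-toℚᵘ j b) ⟩
  (i ℚᵘ./ a) ℚᵘ.* (j ℚᵘ./ b)                ≈⟨ ℚᵘ.≃-refl ⟩
  (i ℤ.* j) ℚᵘ./ (a ℕ.* b)                  ≈⟨ /-toℚᵘ (i ℤ.* j) (a ℕ.* b) ⟨
  ℚ.toℚᵘ ((i ℤ.* j) ℚ./ (a ℕ.* b))          ∎)
  where open import Relation.Binary.Reasoning.Setoid ℚᵘ.≃-setoid

1+n/1 : ∀ n → (ℤ.+ suc n) ℚ./ 1 ≡ 1ℚ + (ℤ.+ n) ℚ./ 1
1+n/1 n = toℚᵘ-injective (begin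
  ℚ.toℚᵘ ((ℤ.+ suc n) ℚ./ 1)              ≈⟨ /-toℚᵘ (ℤ.+ suc n) 1 ⟩
  (ℤ.+ suc n) ℚᵘ./ 1                      ≈⟨ ℚᵘ.*≡* (cong (ℤ._* ℤ.+ 1)
                                               (cong (ℤ._+_ (ℤ.+ 1)) (sym (ℤ.*-identityʳ (ℤ.+ n))))) ⟩
  ℚᵘ.1ℚᵘ ℚᵘ.+ (ℤ.+ n) ℚᵘ./ 1              ≈⟨ ℚᵘ.+-congʳ ℚᵘ.1ℚᵘ (/-toℚᵘ (ℤ.+ n) 1) ⟨
  ℚᵘ.1ℚᵘ ℚᵘ.+ ℚ.toℚᵘ ((ℤ.+ n) ℚ./ 1)      ≈⟨ toℚᵘ-homo-+ 1ℚ ((ℤ.+ n) ℚ./ 1) ⟨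
  ℚ.toℚᵘ (1ℚ + (ℤ.+ n) ℚ./ 1)             ∎)
  where open import Relation.Binary.Reasoning.Setoid ℚᵘ.≃-setoid

n/n≡1 : ∀ n .{{_ : NonZero n}} → (ℤ.+ n) ℚ./ n ≡ 1ℚ
n/n≡1 n@(suc _) = toℚᵘ-injective (ℚᵘ.≃-trans (/-toℚᵘ (ℤ.+ n) n) (ℚᵘ.*≡* (ℤ.*-comm (ℤ.+ n) (ℤ.+ 1))))

0≤* : ∀ {a b} → 0ℚ ≤ a → 0ℚ ≤ b → 0ℚ ≤ a * b
0≤* {a} {b} 0≤a 0≤b = subst (_≤ a * b) (*-zeroʳ a) (*-monoˡ-≤-nonNeg a {{ℚ.nonNegative 0≤a}} 0≤b)

0<* : ∀ {a b} → 0ℚ ℚ.< a → 0ℚ ℚ.< b → 0ℚ ℚ.< a * b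
0<* {a} {b} 0<a 0<b = subst (ℚ._< a * b) (*-zeroʳ a) (*-monoʳ-<-pos a {{ℚ.positive 0<a}} 0<b)

sum-ones : ∀ n → sum {n} (const 1ℚ) ≡ (ℤ.+ n) ℚ./ 1
sum-ones zero    = refl
sum-ones (suc n) = trans (cong (1ℚ +_) (sum-ones n)) (sym (1+n/1 n))

sum-const : ∀ n a → sum {n} (const a) ≡ (ℤ.+ n) ℚ./ 1 * a
sum-const n a = trans
  (trans (sum-cong-≗ {n} (λ _ → sym (*-identityˡ a))) (sym (*-distribʳ-sum {n} a (const 1ℚ))))
  (cong (_* a) (sum-ones n))

sum-mono-< : ∀ n (g h : Fin (suc n) → ℚ) → (∀ i → g i ℚ.< h i) → sum g ℚ.< sum h
sum-mono-< zero    g h g<h = +-monoˡ-< 0ℚ (g<h Fin.zero)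
sum-mono-< (suc n) g h g<h =
  +-mono-< (g<h Fin.zero) (sum-mono-< n (g ∘ Fin.suc) (h ∘ Fin.suc) (g<h ∘ Fin.suc))

-- Some value of a function on a nonempty finite set is at most its average.
below-average : ∀ n .{{_ : NonZero n}} (g : Fin n → ℚ) b →
                sum g ≤ (ℤ.+ n) ℚ./ 1 * b → ∃[ i ] g i ≤ b
below-average n@(suc n-1) g b Σg≤nb with Fin.any? (λ i → g i ≤? b)
... | yes ∃i = ∃i
... | no ¬∃i = contradiction
  (<-≤-trans (subst (ℚ._< sum g) (sum-const n b)
    (sum-mono-< n-1 (const b) g (λ i → ≰⇒> (λ gi≤b → ¬∃i (i , gi≤b)))))
    Σg≤nb)
  (<-irrefl refl)

-- The value 1 if i = j and 0 otherwise.
indicator : ∀ {n} → Fin n → Fin n → ℚ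
indicator i j = if does (i Fin.≟ j) then 1ℚ else 0ℚ

indicator-self : ∀ {n} (i : Fin n) → indicator i i ≡ 1ℚ
indicator-self i with i Fin.≟ i
... | yes _  = refl
... | no i≢i = contradiction refl i≢i

0≤1 : 0ℚ ≤ 1ℚ
0≤1 = nonNegative⁻¹ 1ℚ

0≤indicator : ∀ {n} (i j : Fin n) → 0ℚ ≤ indicator i j
0≤indicator i j with i Fin.≟ j
... | yes _ = 0≤1
... | no  _ = ≤-refl

indicator≤1 : ∀ {n} (i j : Fin n) → indicator i j ≤ 1ℚ
indicator≤1 i j with i Fin.≟ j
... | yes _ = ≤-refl
... | no  _ = 0≤1

indicator-suc : ∀ {n} (i j : Fin n) → indicator (Fin.suc i) (Fin.suc j) ≡ indicator i j
indicator-suc i j with i Fin.≟ j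
... | yes _ = refl
... | no  _ = refl

sum-indicator : ∀ {n} (j : Fin n) → sum (λ i → indicator i j) ≡ 1ℚ
sum-indicator {suc n} Fin.zero    = trans (cong (1ℚ +_) (sum-replicate-zero n)) (+-identityʳ 1ℚ)
sum-indicator {suc n} (Fin.suc j) = trans (+-identityˡ _)
  (trans (sum-cong-≗ {n} (λ i → indicator-suc i j)) (sum-indicator j))

-- The sum of the first n terms.
partialSum : (ℕ → ℚ) → ℕ → ℚ
partialSum u zero    = 0ℚ
partialSum u (suc n) = partialSum u n + u n

partialSum-cong : ∀ {u v} → u ≗ v → partialSum u ≗ partialSum v
partialSum-cong u≗v zero    = refl
partialSum-cong u≗v (suc n) = cong₂ _+_ (partialSum-cong u≗v n) (u≗v n)

partialSum-≤ : ∀ {u v} a → (∀ n → u n ≤ a * v n) → ∀ n → partialSum u n ≤ a * partialSum v n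
partialSum-≤ a u≤av zero    = ≤-reflexive (sym (*-zeroʳ a))
partialSum-≤ {u} {v} a u≤av (suc n) = subst (partialSum u (suc n) ≤_)
  (sym (*-distribˡ-+ a (partialSum v n) (v n)))
  (+-mono-≤ (partialSum-≤ a u≤av n) (u≤av n))

partialSum-mono : ∀ {u} → (∀ n → 0ℚ ≤ u n) → ∀ N k → partialSum u N ≤ partialSum u (N ℕ.+ k)
partialSum-mono {u} 0≤u N zero    rewrite ℕ.+-identityʳ N = ≤-refl
partialSum-mono {u} 0≤u N (suc k) rewrite ℕ.+-suc N k =
  subst (_≤ partialSum u (N ℕ.+ k) + u (N ℕ.+ k)) (+-identityʳ (partialSum u N))
    (+-mono-≤ (partialSum-mono 0≤u N k) (0≤u (N ℕ.+ k)))

term≤partialSum : ∀ {u} → (∀ n → 0ℚ ≤ u n) → ∀ n → u n ≤ partialSum u (suc n)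
term≤partialSum {u} 0≤u n = subst (_≤ partialSum u n + u n) (+-identityˡ (u n))
  (+-monoˡ-≤ (u n) (partialSum-mono 0≤u 0 n))

sum-partialSum : ∀ {m} (u : Fin m → ℕ → ℚ) n →
                 sum (λ i → partialSum (u i) n) ≡ partialSum (λ k → sum (λ i → u i k)) n
sum-partialSum {m} u zero    = sum-replicate-zero m
sum-partialSum {m} u (suc n) = trans (∑-distrib-+ {m} (λ i → partialSum (u i) n) (λ i → u i n))
  (cong (_+ sum (λ i → u i n)) (sum-partialSum u n))

partialSum-* : ∀ a u n → partialSum (λ k → a * u k) n ≡ a * partialSum u n
partialSum-* a u zero    = sym (*-zeroʳ a)
partialSum-* a u (suc n) = trans (cong (_+ a * u n) (partialSum-* a u n))
  (sym (*-distribˡ-+ a (partialSum u n) (u n)))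

-- If u ≤ a v termwise, then every block of consecutive terms of u is at most
-- a times the corresponding block of v; written without subtraction.
tail-≤ : ∀ {u v} a → (∀ n → u n ≤ a * v n) → ∀ N k →
  partialSum u (N ℕ.+ k) + a * partialSum v N ≤ partialSum u N + a * partialSum v (N ℕ.+ k)
tail-≤ a u≤av N zero    rewrite ℕ.+-identityʳ N = ≤-refl
tail-≤ {u} {v} a u≤av N (suc k) rewrite ℕ.+-suc N k = begin
  (U′ + u n) + a * V     ≡⟨ solve 3 (λ x y z → (x :+ y) :+ z := (x :+ z) :+ y) refl U′ (u n) (a * V) ⟩
  (U′ + a * V) + u n     ≤⟨ +-mono-≤ (tail-≤ a u≤av N k) (u≤av n) ⟩
  (U + a * V′) + a * v n ≡⟨ solve 4 (λ x a y z → (x :+ a :* y) :+ a :* z := x :+ a :* (y :+ z)) refl U a V′ (v n) ⟩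
  U + a * (V′ + v n)     ∎
  where
  open ≤-Reasoning
  open +-*-Solver
  n = N ℕ.+ k
  U = partialSum u N
  U′ = partialSum u n
  V = partialSum v N
  V′ = partialSum v n

tail-small : ∀ {u v} a → 0ℚ ≤ a → (∀ n → u n ≤ a * v n) → ∀ N k {δ} →
  partialSum v (N ℕ.+ k) ≤ partialSum v N + δ →
  partialSum u (N ℕ.+ k) ≤ partialSum u N + a * δ
tail-small {u} {v} a 0≤a u≤av N k {δ} small = +-cancelʳ-≤′ (begin
  U′ + a * V          ≤⟨ tail-≤ a u≤av N k ⟩
  U + a * V′          ≤⟨ +-monoʳ-≤ U (*-monoˡ-≤-nonNeg a {{ℚ.nonNegative 0≤a}} small) ⟩
  U + a * (V + δ)     ≡⟨ solve 4 (λ x a y d → x :+ a :* (y :+ d) := (x :+ a :* d) :+ a :* y) refl U a V δ ⟩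
  (U + a * δ) + a * V ∎)
  where
  open ≤-Reasoning
  open +-*-Solver
  U = partialSum u N
  U′ = partialSum u (N ℕ.+ k)
  V = partialSum v N
  V′ = partialSum v (N ℕ.+ k)
  +-cancelʳ-≤′ : ∀ {p q r} → p + r ≤ q + r → p ≤ q
  +-cancelʳ-≤′ {p} {q} {r} p+r≤q+r = subst₂ _≤_ (eq p) (eq q) (+-monoˡ-≤ (ℚ.- r) p+r≤q+r)
    where
    eq : ∀ x → x + r + ℚ.- r ≡ x
    eq x = solve 2 (λ x r → x :+ r :+ (:- r) := x) refl x r

-- The series of u converges, with partial sums at most b.  The modulus of
-- convergence is the datum that makes the choices below computable.
record SeriesBelow (u : ℕ → ℚ) (b : ℚ) : Set where
  field
    bounded   : ∀ n → partialSum u n ≤ b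
    converges : ∀ δ → 0ℚ ℚ.< δ → ∃[ N ] ∀ k → partialSum u (N ℕ.+ k) ≤ partialSum u N + δ

open SeriesBelow

-- Null sets of random symbols

module Update {A : Set} (_≟_ : DecidableEquality A) {B : Set} where

  -- The function g with its value at x replaced by b.
  update : (A → B) → A → B → A → B
  update g x b y with y ≟ x
  ... | yes _ = b
  ... | no  _ = g y

  update-hit : ∀ g x b → update g x b x ≡ b
  update-hit g x b with x ≟ x
  ... | yes _  = refl
  ... | no x≢x = contradiction refl x≢x

  update-miss : ∀ g x b y → y ≢ x → update g x b y ≡ g y
  update-miss g x b y y≢x with y ≟ x
  ... | yes y≡x = contradiction y≡x y≢x
  ... | no  _   = refl

module NullSets (m : ℕ) {{m≢0 : NonZero m}} (t : ℕ) where

  open UniformMeasure m t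

  _≟ˢ_ : DecidableEquality Site
  _≟ˢ_ = ≡-dec Fin._≟_ ℤ._≟_

  module _ {B : Set} where
    open Update _≟ˢ_ {B} public

  -- The number of symbols and the probability of each.
  M κ : ℚ
  M = (ℤ.+ m) ℚ./ 1
  κ = (ℤ.+ 1) ℚ./ m

  M*κ≡1 : M * κ ≡ 1ℚ
  M*κ≡1 = trans (/-* (ℤ.+ m) (ℤ.+ 1) 1 m {{_}} {{m≢0}} {{ℕ.m*n≢0 1 m}})
    (trans (/-cong {{ℕ.m*n≢0 1 m}} (ℤ.*-identityʳ (ℤ.+ m)) (ℕ.*-identityˡ m)) (n/n≡1 m))

  0<κ : 0ℚ ℚ.< κ
  0<κ = positive⁻¹ κ {{normalize-pos 1 m}}

  0≤κ : 0ℚ ≤ κ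
  0≤κ = <⇒≤ 0<κ

  0≤M : 0ℚ ≤ M
  0≤M = nonNegative⁻¹ M {{normalize-nonNeg m 1}}

  1≤M : 1ℚ ≤ M
  1≤M = subst (1ℚ ≤_) (sum-ones m) (one≤ m)
    where
    one≤ : ∀ n .{{_ : NonZero n}} → 1ℚ ≤ sum {n} (const 1ℚ)
    one≤ (suc n) = subst (1ℚ ≤_) (cong (1ℚ +_) (sym (sum-ones n)))
      (subst (_≤ 1ℚ + (ℤ.+ n) ℚ./ 1) (+-identityʳ 1ℚ)
        (+-monoʳ-≤ 1ℚ (nonNegative⁻¹ ((ℤ.+ n) ℚ./ 1) {{normalize-nonNeg n 1}})))

  -- An assignment of a weight to every symbol at every site.  The weights at one
  -- site need not add up to 1.
  Weight : Set
  Weight = Site → Fin m → ℚ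

  NonNeg : Weight → Set
  NonNeg w = ∀ x r → 0ℚ ≤ w x r

  -- The product of the weights of the constraints.  For the uniform weight this
  -- is the volume of the cylinder; giving weight 1 to one symbol of a site and 0
  -- to the others conditions on that symbol, and giving weight 1 to every symbol
  -- of a site forgets the constraint there.
  mass : Weight → List (Site × Fin m) → ℚ
  mass w []             = 1ℚ
  mass w ((x , r) ∷ cs) = w x r * mass w cs

  0≤mass : ∀ {w} → NonNeg w → ∀ cs → 0ℚ ≤ mass w cs
  0≤mass 0≤w []             = 0≤1
  0≤mass 0≤w ((x , r) ∷ cs) = 0≤* (0≤w x r) (0≤mass 0≤w cs)

  -- w and w′ differ at most at x.
  AgreeOff : Site → Weight → Weight → Set
  AgreeOff x w w′ = ∀ {y} → y ≢ x → ∀ r → w′ y r ≡ w y r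

  mass-cong-off : ∀ {x w w′} → AgreeOff x w w′ → ∀ cs → All (x ≢_) (List.map proj₁ cs) →
                  mass w′ cs ≡ mass w cs
  mass-cong-off w≈w′ []             []         = refl
  mass-cong-off w≈w′ ((y , r) ∷ cs) (x≢y ∷ x∉) =
    cong₂ _*_ (w≈w′ (x≢y ∘ sym) r) (mass-cong-off w≈w′ cs x∉)

  -- A cylinder has at most one constraint at x, so multiplying the weights there
  -- by at most M multiplies the mass by at most M.
  mass-≤ : ∀ {x w w′} → NonNeg w → AgreeOff x w w′ → (∀ r → w′ x r ≤ M * w x r) →
           ∀ cs → Unique (List.map proj₁ cs) → mass w′ cs ≤ M * mass w cs
  mass-≤ 0≤w w≈w′ w′≤ [] _ = subst (1ℚ ≤_) (sym (*-identityʳ M)) 1≤M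
  mass-≤ {x} {w} {w′} 0≤w w≈w′ w′≤ ((y , r) ∷ cs) (y∉ ∷ uniq) with y ≟ˢ x
  ... | yes refl = subst₂ _≤_ (cong (w′ y r *_) (sym (mass-cong-off w≈w′ cs y∉)))
                     (*-assoc M (w y r) (mass w cs))
                     (*-monoʳ-≤-nonNeg (mass w cs) {{ℚ.nonNegative (0≤mass 0≤w cs)}} (w′≤ r))
  ... | no y≢x   = subst₂ _≤_ (cong (_* mass w′ cs) (sym (w≈w′ y≢x r)))
                     (solve 3 (λ a b c → a :* (b :* c) := b :* (a :* c)) refl (w y r) M (mass w cs))
                     (*-monoˡ-≤-nonNeg (w y r) {{ℚ.nonNegative (0≤w y r)}} (mass-≤ 0≤w w≈w′ w′≤ cs uniq))
    where open +-*-Solver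

  -- The law of total probability: if averaging the weights ws i at x over i gives
  -- w, then averaging the masses gives the mass for w.
  mass-average : ∀ {x w} (ws : Fin m → Weight) → (∀ i → AgreeOff x w (ws i)) →
                 (∀ r → sum (λ i → ws i x r) ≡ M * w x r) →
                 ∀ cs → Unique (List.map proj₁ cs) → sum (λ i → mass (ws i) cs) ≡ M * mass w cs
  mass-average ws w≈ws avg [] _ = trans (sum-ones m) (sym (*-identityʳ M))
  mass-average {x} {w} ws w≈ws avg ((y , r) ∷ cs) (y∉ ∷ uniq) with y ≟ˢ x
  ... | yes refl = begin
    sum (λ i → ws i y r * mass (ws i) cs) ≡⟨ sum-cong-≗ {m} (λ i → cong (ws i y r *_) (mass-cong-off (w≈ws i) cs y∉)) ⟩
    sum (λ i → ws i y r * mass w cs)      ≡⟨ *-distribʳ-sum {m} (mass w cs) (λ i → ws i y r) ⟨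
    sum (λ i → ws i y r) * mass w cs      ≡⟨ cong (_* mass w cs) (avg r) ⟩
    M * w y r * mass w cs                 ≡⟨ *-assoc M (w y r) (mass w cs) ⟩
    M * (w y r * mass w cs)               ∎
    where open ≡-Reasoning
  ... | no y≢x = begin
    sum (λ i → ws i y r * mass (ws i) cs) ≡⟨ sum-cong-≗ {m} (λ i → cong (_* mass (ws i) cs) (w≈ws i y≢x r)) ⟩
    sum (λ i → w y r * mass (ws i) cs)    ≡⟨ *-distribˡ-sum {m} (w y r) (λ i → mass (ws i) cs) ⟨
    w y r * sum (λ i → mass (ws i) cs)    ≡⟨ cong (w y r *_) (mass-average ws w≈ws avg cs uniq) ⟩
    w y r * (M * mass w cs)               ≡⟨ solve 3 (λ a b c → a :* (b :* c) := b :* (a :* c)) refl (w y r) M (mass w cs) ⟩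
    M * (w y r * mass w cs)               ∎
    where
    open ≡-Reasoning
    open +-*-Solver

  -- The empty set, encoded by nothing, has mass 0.
  mass? : Weight → Maybe Cylinder → ℚ
  mass? w nothing  = 0ℚ
  mass? w (just C) = mass w (Cylinder.constraints C)

  0≤mass? : ∀ {w} → NonNeg w → ∀ C → 0ℚ ≤ mass? w C
  0≤mass? 0≤w nothing  = ≤-refl
  0≤mass? 0≤w (just C) = 0≤mass 0≤w (Cylinder.constraints C)

  mass?-≤ : ∀ {x w w′} → NonNeg w → AgreeOff x w w′ → (∀ r → w′ x r ≤ M * w x r) →
            ∀ C → mass? w′ C ≤ M * mass? w C
  mass?-≤ 0≤w w≈w′ w′≤ nothing  = ≤-reflexive (sym (*-zeroʳ M))
  mass?-≤ 0≤w w≈w′ w′≤ (just C) = mass-≤ 0≤w w≈w′ w′≤ _ (Cylinder.distinct C)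

  mass?-average : ∀ {x w} (ws : Fin m → Weight) → (∀ i → AgreeOff x w (ws i)) →
                  (∀ r → sum (λ i → ws i x r) ≡ M * w x r) →
                  ∀ C → sum (λ i → mass? (ws i) C) ≡ M * mass? w C
  mass?-average ws w≈ws avg nothing  = trans (sum-replicate-zero m) (sym (*-zeroʳ M))
  mass?-average ws w≈ws avg (just C) = mass-average ws w≈ws avg _ (Cylinder.distinct C)

  uniform : Weight
  uniform x r = κ

  mass-uniform : ∀ cs → mass uniform cs ≡ ((ℤ.+ 1) ℚ./ (m ℕ.^ length cs)) {{ℕ.m^n≢0 m (length cs)}}
  mass-uniform []       = refl
  mass-uniform (c ∷ cs) = trans (cong (κ *_) (mass-uniform cs))
    (/-* (ℤ.+ 1) (ℤ.+ 1) m (m ℕ.^ length cs) {{m≢0}} {{ℕ.m^n≢0 m (length cs)}} {{ℕ.m^n≢0 m (suc (length cs))}})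

  mass?-uniform : ∀ C → mass? uniform C ≡ volume C
  mass?-uniform nothing  = refl
  mass?-uniform (just C) = mass-uniform (Cylinder.constraints C)

  volumeBelow-partialSum : ∀ C n → volumeBelow C n ≡ partialSum (mass? uniform ∘ C) n
  volumeBelow-partialSum C zero    = refl
  volumeBelow-partialSum C (suc n) =
    cong₂ _+_ (volumeBelow-partialSum C n) (sym (mass?-uniform (C n)))

  -- Partial assignments of symbols to sites; nothing marks an undecided site.
  Partial : Set
  Partial = Site → Maybe (Fin m)

  -- The distribution of the symbol at a site: uniform if undecided, otherwise
  -- concentrated on the decided symbol.
  density : Maybe (Fin m) → Fin m → ℚ
  density nothing  r = κ
  density (just v) r = indicator v r

  0≤density : ∀ d r → 0ℚ ≤ density d r
  0≤density nothing  r = 0≤κ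
  0≤density (just v) r = 0≤indicator v r

  sum-density : ∀ r → sum (λ v → density (just v) r) ≡ M * density nothing r
  sum-density r = trans (sum-indicator r) (sym M*κ≡1)

  density-≤ : ∀ {d v} → d ≡ nothing ⊎ d ≡ just v → ∀ r → density (just v) r ≤ M * density d r
  density-≤ {v = v} (inj₁ refl) r = ≤-trans (indicator≤1 v r) (≤-reflexive (sym M*κ≡1))
  density-≤ {v = v} (inj₂ refl) r = subst (_≤ M * indicator v r) (*-identityˡ (indicator v r))
    (*-monoʳ-≤-nonNeg (indicator v r) {{ℚ.nonNegative (0≤indicator v r)}} 1≤M)

  Mκ* : ∀ b → M * (κ * b) ≡ b
  Mκ* b = trans (sym (*-assoc M κ b)) (trans (cong (_* b) M*κ≡1) (*-identityˡ b))

  -- κ * δ is the tolerance for v that gives the tolerance δ for u.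
  converges-≤ : ∀ {u v b} → (∀ n → u n ≤ M * v n) → SeriesBelow v b →
                ∀ δ → 0ℚ ℚ.< δ → ∃[ N ] ∀ k → partialSum u (N ℕ.+ k) ≤ partialSum u N + δ
  converges-≤ {u} u≤Mv below δ 0<δ =
    let N , small = converges below (κ * δ) (0<* 0<κ 0<δ) in
    N , λ k → subst (λ e → partialSum u (N ℕ.+ k) ≤ partialSum u N + e) (Mκ* δ)
          (tail-small M 0≤M u≤Mv N k (small k))

  scale : ∀ {u v b} → (∀ n → u n ≤ M * v n) → SeriesBelow v (κ * b) → SeriesBelow u b
  scale {u} {v} {b} u≤Mv below = record
    { bounded   = λ n → ≤-trans (partialSum-≤ M u≤Mv n)
                    (subst (M * partialSum v n ≤_) (Mκ* b)
                      (*-monoˡ-≤-nonNeg M {{ℚ.nonNegative 0≤M}} (bounded below n)))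
    ; converges = converges-≤ u≤Mv below
    }

  -- budget k b = κ ^ (k + 1) * b: deciding k sites and ignoring one more multiplies
  -- volumes by at most M each time, which turns budget k b into b.
  budget : ℕ → ℚ → ℚ
  budget zero    b = κ * b
  budget (suc k) b = budget k (κ * b)

  0<budget : ∀ k {b} → 0ℚ ℚ.< b → 0ℚ ℚ.< budget k b
  0<budget zero    0<b = 0<* 0<κ 0<b
  0<budget (suc k) 0<b = 0<budget k (0<* 0<κ 0<b)

  -- A point outside all the sets C n is built, whatever its symbol at x₀: hence
  -- the constraints at x₀ are ignored, by giving every symbol weight 1 there.
  module Avoid (x₀ : Site) (C : ℕ → Maybe Cylinder) where

    weight : Partial → Weight
    weight p = update (density ∘ p) x₀ (const 1ℚ)

    0≤weight : ∀ p → NonNeg (weight p)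
    0≤weight p x r with x ≟ˢ x₀
    ... | yes _ = 0≤1
    ... | no  _ = 0≤density (p x) r

    weight-update-off : ∀ p x d → AgreeOff x (weight p) (weight (update p x d))
    weight-update-off p x d {y} y≢x r with y ≟ˢ x₀
    ... | yes _ = refl
    ... | no  _ = cong (λ e → density e r) (update-miss p x d y y≢x)

    weight-update-≤ : ∀ p x v → p x ≡ nothing ⊎ p x ≡ just v →
                      ∀ r → weight (update p x (just v)) x r ≤ M * weight p x r
    weight-update-≤ p x v px r with x ≟ˢ x₀
    ... | yes _ = subst (1ℚ ≤_) (sym (*-identityʳ M)) 1≤M
    ... | no  _ = subst (λ d → density d r ≤ M * density (p x) r) (sym (update-hit p x (just v)))
                    (density-≤ px r)

    weight-update-sum : ∀ p x → p x ≡ nothing →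
                        ∀ r → sum (λ v → weight (update p x (just v)) x r) ≡ M * weight p x r
    weight-update-sum p x px≡ r with x ≟ˢ x₀
    ... | yes _ = trans (sum-ones m) (sym (*-identityʳ M))
    ... | no  _ = trans (sum-cong-≗ {m} (λ v → cong (λ d → density d r) (update-hit p x (just v))))
                    (trans (sum-density r) (cong (λ d → M * density d r) (sym px≡)))

    -- The volume of C n, with any constraint at x₀ dropped, conditioned on p.
    cost : Partial → ℕ → ℚ
    cost p n = mass? (weight p) (C n)

    0≤cost : ∀ p n → 0ℚ ≤ cost p n
    0≤cost p n = 0≤mass? (0≤weight p) (C n)

    cost-update-≤ : ∀ p x v → p x ≡ nothing ⊎ p x ≡ just v →
                    ∀ n → cost (update p x (just v)) n ≤ M * cost p n
    cost-update-≤ p x v px n =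
      mass?-≤ (0≤weight p) (weight-update-off p x (just v)) (weight-update-≤ p x v px) (C n)

    -- Conditioned on p, the sets C n have total volume at most some b < 1.
    Affordable : Partial → Set
    Affordable p = ∃[ b ] b ℚ.< 1ℚ × SeriesBelow (cost p) b

    -- An affordable partial assignment can be extended to any undecided site x.
    -- For N large, the terms after N contribute at most δ = b′ - b whatever symbol
    -- is chosen at x, where b < b′ < 1.  The sum of the first N terms, averaged over
    -- the symbols at x, is what it was before, at most b; so some symbol keeps it
    -- at most b, and the whole series at most b′.
    decide : ∀ p x → p x ≡ nothing → Affordable p → ∃[ v ] Affordable (update p x (just v))
    decide p x px≡ (b , b<1 , light) = v , b′ , b′<1 , record
      { bounded   = λ n → ≤-trans (≤-trans
                      (subst (λ k → partialSum (cost p′) n ≤ partialSum (cost p′) k) (ℕ.+-comm n N)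
                        (partialSum-mono (0≤cost p′) n N))
                      (tail-bound n))
                      (≤-trans (+-monoˡ-≤ δ v-best)
                        (≤-reflexive (solve 2 (λ b c → b :+ (c :- b) := c) refl b b′)))
      ; converges = converges-≤ (cost-update-≤ p x v (inj₁ px≡)) light
      }
      where
      open +-*-Solver
      between = <-dense b<1
      b′ = proj₁ between
      b<b′ = proj₁ (proj₂ between)
      b′<1 = proj₂ (proj₂ between)
      δ = b′ - b
      0<δ : 0ℚ ℚ.< δ
      0<δ = subst (ℚ._< δ) (+-inverseʳ b) (+-monoˡ-< (ℚ.- b) b<b′)
      modulus = converges light (κ * δ) (0<* 0<κ 0<δ)
      N = proj₁ modulus
      average : sum (λ v → partialSum (cost (update p x (just v))) N) ≤ M * b
      average = ≤-trans
        (≤-reflexive (trans (sum-partialSum (λ v → cost (update p x (just v))) N)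
          (trans (partialSum-cong (λ n → mass?-average _ (λ v → weight-update-off p x (just v))
                                            (weight-update-sum p x px≡) (C n)) N)
                 (partialSum-* M (cost p) N))))
        (*-monoˡ-≤-nonNeg M {{ℚ.nonNegative 0≤M}} (bounded light N))
      best = below-average m (λ v → partialSum (cost (update p x (just v))) N) b average
      v = proj₁ best
      v-best = proj₂ best
      p′ = update p x (just v)
      tail-bound : ∀ n → partialSum (cost p′) (N ℕ.+ n) ≤ partialSum (cost p′) N + δ
      tail-bound n = subst (λ e → partialSum (cost p′) (N ℕ.+ n) ≤ partialSum (cost p′) N + e) (Mκ* δ)
        (tail-small M 0≤M (cost-update-≤ p x v (inj₁ px≡)) N n (proj₂ modulus n))

    -- p′ extends p.
    _⊑_ : Partial → Partial → Set
    p ⊑ p′ = ∀ {y v} → p y ≡ just v → p′ y ≡ just v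

    Decided : Partial → Site → Set
    Decided p x = ∃[ v ] p x ≡ just v

    decide-list : ∀ xs p → Affordable p →
                  ∃[ p′ ] Affordable p′ × p ⊑ p′ × (∀ {x} → x ∈ xs → Decided p′ x)
    decide-list []       p good = p , good , (λ eq → eq) , λ ()
    decide-list (x ∷ xs) p good with p x in px≡
    ... | just v =
      let p′ , good′ , p⊑p′ , xs-decided = decide-list xs p good in
      p′ , good′ , p⊑p′ , λ { (here refl) → v , p⊑p′ px≡ ; (there x∈xs) → xs-decided x∈xs }
    ... | nothing =
      let v , good₁ = decide p x px≡ good
          p′ , good′ , p₁⊑p′ , xs-decided = decide-list xs (update p x (just v)) good₁
      in p′ , good′ ,
         (λ {y} py≡ → p₁⊑p′ (trans (update-miss p x (just v) y
            (λ { refl → contradiction (trans (sym px≡) py≡) (λ ()) })) py≡)) ,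
         λ { (here refl)  → v , p₁⊑p′ (update-hit p x (just v))
           ; (there x∈xs) → xs-decided x∈xs }

    -- The sites whose cell is n or -n.
    shell : ℕ → List Site
    shell n = List.cartesianProduct (List.allFin t) ((ℤ.+ n) ∷ (ℤ.- (ℤ.+ n)) ∷ [])

    ∈-shell : ∀ i z → (i , z) ∈ shell ℤ.∣ z ∣
    ∈-shell i z = ∈-cartesianProduct⁺ (∈-allFin i) (∈± z)
      where
      ∈± : ∀ z → z ∈ ((ℤ.+ ℤ.∣ z ∣) ∷ (ℤ.- (ℤ.+ ℤ.∣ z ∣)) ∷ [])
      ∈± (ℤ.+ n)      = here refl
      ∈± (ℤ.-[1+ n ]) = there (here refl)

    -- Deciding the shells one after the other extends an affordable p to a total
    -- assignment.
    module Complete (p : Partial) (good : Affordable p) where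

      stage : ℕ → ∃[ q ] Affordable q
      stage-step : ∀ n → ∃[ q ] Affordable q × proj₁ (stage n) ⊑ q × (∀ {x} → x ∈ shell n → Decided q x)

      stage zero    = p , good
      stage (suc n) = proj₁ (stage-step n) , proj₁ (proj₂ (stage-step n))

      stage-step n = decide-list (shell n) (proj₁ (stage n)) (proj₂ (stage n))

      at : ℕ → Partial
      at n = proj₁ (stage n)

      at-mono : ∀ n k → at n ⊑ at (k ℕ.+ n)
      at-mono n zero    eq = eq
      at-mono n (suc k) eq = proj₁ (proj₂ (proj₂ (stage-step (k ℕ.+ n)))) (at-mono n k eq)

      at-≤ : ∀ {n k} → n ℕ.≤ k → at n ⊑ at k
      at-≤ {n} {k} n≤k {y} {v} eq = subst (λ j → at j y ≡ just v) (ℕ.m∸n+n≡m n≤k) (at-mono n (k ℕ.∸ n) eq)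

      -- The first stage at which a site is certainly decided.
      norm : Site → ℕ
      norm (i , z) = suc ℤ.∣ z ∣

      decided : ∀ x → Decided (at (norm x)) x
      decided (i , z) = proj₂ (proj₂ (proj₂ (stage-step ℤ.∣ z ∣))) (∈-shell i z)

      limit : Site → Fin m
      limit x = proj₁ (decided x)

      at-limit : ∀ x {k} → norm x ℕ.≤ k → at k x ≡ just (limit x)
      at-limit x ≤k = at-≤ ≤k (proj₂ (decided x))

      limit-extends : ∀ {x v} → p x ≡ just v → limit x ≡ v
      limit-extends {x} px≡ =
        just-injective (trans (sym (proj₂ (decided x))) (at-≤ {zero} {norm x} ℕ.z≤n px≡))

      -- If the limit satisfies the constraints cs, up to a change at x₀, then cs has
      -- conditional volume 1 at all late stages.
      mass-at : ∀ r cs → All (λ { ((i , z) , v) → update limit x₀ r (i , z) ≡ v }) cs →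
                ∃[ K ] ∀ {k} → K ℕ.≤ k → mass (weight (at k)) cs ≡ 1ℚ
      mass-at r [] [] = 0 , λ _ → refl
      mass-at r ((x , v) ∷ cs) (eq ∷ eqs) with mass-at r cs eqs
      ... | K , mass≡1 = norm x ℕ.⊔ K , λ {k} ≤k → trans
        (cong₂ _*_ (weight≡1 (ℕ.m⊔n≤o⇒m≤o (norm x) K ≤k)) (mass≡1 (ℕ.m⊔n≤o⇒n≤o (norm x) K ≤k)))
        (*-identityˡ 1ℚ)
        where
        weight≡1 : ∀ {k} → norm x ℕ.≤ k → weight (at k) x v ≡ 1ℚ
        weight≡1 {k} ≤k with x ≟ˢ x₀
        ... | yes _ = refl
        ... | no  _ = trans (cong (λ d → density d v) (at-limit x ≤k))
                        (trans (cong (indicator (limit x)) (sym eq)) (indicator-self (limit x)))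

      -- Otherwise the conditional volume of C n would be 1 at some stage, whereas
      -- at every stage the total over all n is below 1.
      limit-avoids : ∀ r n → ¬ Maybe.Any (curry (update limit x₀ r) ∈ᶜ_) (C n)
      limit-avoids r n hit with C n in Cn≡
      limit-avoids r n (Maybe.just hit) | just D =
        let K , mass≡1 = mass-at r (Cylinder.constraints D) hit
            b , b<1 , light = proj₂ (stage K)
            one≤b : 1ℚ ≤ b
            one≤b = ≤-trans
              (≤-reflexive (trans (sym (mass≡1 ℕ.≤-refl)) (cong (mass? (weight (at K))) (sym Cn≡))))
              (≤-trans (term≤partialSum (0≤cost (at K)) n) (bounded light (suc n)))
        in <-irrefl refl (<-≤-trans b<1 one≤b)

    module Pin (s : Site → Fin m) where

      -- The partial assignment that agrees with s on L and is undecided elsewhere.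
      pin : List Site → Partial
      pin []      = const nothing
      pin (x ∷ L) = update (pin L) x (just (s x))

      pin-consistent : ∀ L x → pin L x ≡ nothing ⊎ pin L x ≡ just (s x)
      pin-consistent []      x = inj₁ refl
      pin-consistent (y ∷ L) x with x ≟ˢ y
      ... | yes refl = inj₂ refl
      ... | no  _    = pin-consistent L x

      pin-∈ : ∀ {L x} → x ∈ L → pin L x ≡ just (s x)
      pin-∈ {y ∷ L} {x} x∈ with x ≟ˢ y
      pin-∈ x∈           | yes refl = refl
      pin-∈ (here x≡y)   | no x≢y   = contradiction x≡y x≢y
      pin-∈ (there x∈L)  | no _     = pin-∈ x∈L

      -- Starting from the volumes, x₀ is ignored first, and then L is decided.
      pin-light : ∀ L {b} → SeriesBelow (mass? uniform ∘ C) (budget (length L) b) →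
                  SeriesBelow (cost (pin L)) b
      pin-light []      = scale λ n → mass?-≤ (λ _ _ → 0≤κ) off at-x₀ (C n)
        where
        off : AgreeOff x₀ uniform (weight (const nothing))
        off y≢x₀ r = cong (λ g → g r) (update-miss (λ _ → density nothing) x₀ (const 1ℚ) _ y≢x₀)
        at-x₀ : ∀ r → weight (const nothing) x₀ r ≤ M * κ
        at-x₀ r = ≤-reflexive (trans
          (cong (λ g → g r) (update-hit (λ _ → density nothing) x₀ (const 1ℚ))) (sym M*κ≡1))
      pin-light (x ∷ L) = scale (cost-update-≤ (pin L) x (s x) (pin-consistent L x)) ∘ pin-light L

  -- A set of outer measure 0 does not contain every point of a cylinder; more precisely,
  -- the cylinder has a point that stays outside the set under all changes of its
  -- symbol at x₀.
  null-avoidable : ∀ {B : Pred Ω 0ℓ} → OuterMeasure≤ B 0ℚ →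
                   (s : Ω) (L : List Site) (x₀ : Site) →
                   ∃[ ω ] (∀ {i z} → (i , z) ∈ L → ω (i , z) ≡ s i z) ×
                          (∀ r → ¬ B (curry (update ω x₀ r)))
  null-avoidable {B} null s L x₀ =
    limit , (λ {i} {z} x∈L → limit-extends (pin-∈ x∈L)) ,
    λ r b∈B → uncurry (limit-avoids r) (covers (curry (update limit x₀ r)) b∈B)
    where
    cover = null (budget (length L) ½) (0<budget (length L) (positive⁻¹ ½))
    open Cover cover using (cylinders; covers)
    open Avoid x₀ cylinders
    open Pin (uncurry s)
    light : SeriesBelow (mass? uniform ∘ cylinders) (budget (length L) ½)
    light = record
      { bounded   = λ n → subst₂ _≤_ (volumeBelow-partialSum cylinders n)
                      (+-identityˡ (budget (length L) ½)) (Cover.bounded cover n)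
      ; converges = λ δ 0<δ → let N , small = Cover.converges cover δ 0<δ in
          N , λ k → subst₂ (λ a b → a ≤ b + δ) (volumeBelow-partialSum cylinders (N ℕ.+ k))
                (volumeBelow-partialSum cylinders N) (small k)
      }
    open Complete (pin L) (½ , *<* (ℤ.+<+ (ℕ.s≤s (ℕ.s≤s ℕ.z≤n))) , pin-light L light)

-- Functions with prescribed values and sums over finite supports

map-fromList-cong : ∀ {A B : Set} {g h : A → B} (W : List A) → (∀ {v} → v ∈ W → g v ≡ h v) →
                    Vec.map g (Vec.fromList W) ≡ Vec.map h (Vec.fromList W)
map-fromList-cong []      g≈h = refl
map-fromList-cong (v ∷ W) g≈h = cong₂ _∷_ (g≈h (here refl)) (map-fromList-cong W (g≈h ∘ there))

-- Any tuple of values is taken by some function at the points of a repetition-free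
-- list; d is its value elsewhere.
interpolate : ∀ {B : Set} (W : List ℤ) → Unique W → B → (a : Vec B (length W)) →
              ∃[ g ] Vec.map g (Vec.fromList W) ≡ a
interpolate []      []            d []      = const d , refl
interpolate {B} (v ∷ W) (v∉W ∷ uniq) d (x ∷ a) =
  let g , g≡a = interpolate W uniq d a in
  update g v x ,
  cong₂ _∷_ (update-hit g v x)
    (trans (map-fromList-cong W (λ u∈W → update-miss g v x _ (λ { refl → All.lookup v∉W u∈W refl }))) g≡a)
  where open Update ℤ._≟_ {B}

-- The vector xs with last entry a.
snoc : ∀ {A : Set} {n} → Vector A n → A → Vector A (suc n)
snoc {n = zero}  xs a i           = a
snoc {n = suc n} xs a Fin.zero    = head xs
snoc {n = suc n} xs a (Fin.suc i) = snoc (tail xs) a i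

snoc-inject₁ : ∀ {A : Set} {n} (xs : Vector A n) a i → snoc xs a (inject₁ i) ≡ xs i
snoc-inject₁ {n = suc n} xs a Fin.zero    = refl
snoc-inject₁ {n = suc n} xs a (Fin.suc i) = snoc-inject₁ (tail xs) a i

module _ (g : ℤ → ℕ) where

  nonzero? : ∀ z → Dec (g z ≢ 0)
  nonzero? z = ¬? (g z ℕ.≟ 0)

  sum-nonzero : ∀ xs → sumᴺ (List.map g (filter nonzero? xs)) ≡ sumᴺ (List.map g xs)
  sum-nonzero []       = refl
  sum-nonzero (x ∷ xs) with nonzero? x
  ... | yes gx≢0 = trans (cong (sumᴺ ∘ List.map g) (filter-accept nonzero? gx≢0))
                     (cong (g x ℕ.+_) (sum-nonzero xs))
  ... | no ¬gx≢0 = trans (cong (sumᴺ ∘ List.map g) (filter-reject nonzero? ¬gx≢0))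
                     (trans (sum-nonzero xs) (cong (ℕ._+ sumᴺ (List.map g xs))
                       (sym (decidable-stable (g x ℕ.≟ 0) ¬gx≢0))))

  -- Σ g over a repetition-free list containing the support of g does not depend on
  -- the list: the supports, listed in two orders, are permutations of each other.
  sum-support : ∀ {xs ys} → Unique xs → Unique ys →
                (∀ z → g z ≢ 0 → z ∈ xs) → (∀ z → g z ≢ 0 → z ∈ ys) →
                sumᴺ (List.map g xs) ≡ sumᴺ (List.map g ys)
  sum-support {xs} {ys} !xs !ys ⊆xs ⊆ys = begin
    sumᴺ (List.map g xs)                   ≡⟨ sum-nonzero xs ⟨
    sumᴺ (List.map g (filter nonzero? xs)) ≡⟨ sum-↭ (map⁺ g (∼bag⇒↭ (unique∧set⇒bag
                                                (Unique.filter⁺ nonzero? !xs) (Unique.filter⁺ nonzero? !ys)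
                                                (mk⇔ (transfer xs ⊆ys) (transfer ys ⊆xs))))) ⟩
    sumᴺ (List.map g (filter nonzero? ys)) ≡⟨ sum-nonzero ys ⟩
    sumᴺ (List.map g ys)                   ∎
    where
    open ≡-Reasoning
    transfer : ∀ xs {ys} → (∀ z → g z ≢ 0 → z ∈ ys) →
               ∀ {z} → z ∈ filter nonzero? xs → z ∈ filter nonzero? ys
    transfer xs ⊆ys z∈ = let _ , gz≢0 = ∈-filter⁻ nonzero? {xs = xs} z∈ in
                         ∈-filter⁺ nonzero? (⊆ys _ gz≢0) gz≢0

-- Totals of finite configurations and locality of the iterates

module _ (F : SCA) where
  open SCA F

  -- Both totals can be computed over one list z₀ ∷ rest containing the two supports;
  -- the parts over rest agree and cancel.
  total-determines : ∀ {c c′ : Config} (fin : Finite F c) (fin′ : Finite F c′) z₀ →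
                     (∀ {z} → z ≢ z₀ → c z ≡ c′ z) → total F fin ≡ total F fin′ → c z₀ ≡ c′ z₀
  total-determines {c} {c′} fin fin′ z₀ c≈c′ total≡ =
    Fin.toℕ-injective (ℕ.+-cancelʳ-≡ _ _ _ (begin
      toℕ (c z₀)  ℕ.+ sumᴺ (List.map (toℕ ∘ c)  rest) ≡⟨ total≡sum fin ∈-++⁺ˡ ⟨
      total F fin                                     ≡⟨ total≡ ⟩
      total F fin′                                    ≡⟨ total≡sum fin′ (∈-++⁺ʳ (Finite.cells fin)) ⟩
      toℕ (c′ z₀) ℕ.+ sumᴺ (List.map (toℕ ∘ c′) rest) ≡⟨ cong (λ k → toℕ (c′ z₀) ℕ.+ sumᴺ k) (rest≡ !U) ⟨
      toℕ (c′ z₀) ℕ.+ sumᴺ (List.map (toℕ ∘ c)  rest) ∎))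
    where
    open ≡-Reasoning
    both = Finite.cells fin ++ Finite.cells fin′
    rest = filter (¬? ∘ (z₀ ℤ.≟_)) (deduplicate ℤ._≟_ both)
    U = z₀ ∷ rest
    !U : Unique U
    !U = deduplicate-! (z₀ ∷ both)
    ⊆U : ∀ {z} → z ∈ both → z ∈ U
    ⊆U z∈ = ∈-deduplicate⁺ ℤ._≟_ (there {x = z₀} z∈)
    total≡sum : ∀ {c} (fin : Finite F c) → (∀ {z} → z ∈ Finite.cells fin → z ∈ both) →
                total F fin ≡ sumᴺ (List.map (toℕ ∘ c) U)
    total≡sum {c} fin ⊆both = sum-support (toℕ ∘ c) (Finite.unique fin) !U
      (Finite.complete fin) (λ z nz → ⊆U (⊆both (Finite.complete fin z nz)))
    rest≡ : Unique U → List.map (toℕ ∘ c) rest ≡ List.map (toℕ ∘ c′) rest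
    rest≡ (z₀∉ ∷ _) = go rest z₀∉
      where
      go : ∀ xs → All (z₀ ≢_) xs → List.map (toℕ ∘ c) xs ≡ List.map (toℕ ∘ c′) xs
      go []       []         = refl
      go (x ∷ xs) (z₀≢x ∷ p) = cong₂ _∷_ (cong toℕ (c≈c′ (z₀≢x ∘ sym))) (go xs p)

  global-cong : ∀ (c c′ : Config) (s s′ : ℤ → R) z → (∀ {v} → v ∈ V → c (z ℤ.+ v) ≡ c′ (z ℤ.+ v)) →
                (∀ {v} → v ∈ V′ → s (z ℤ.+ v) ≡ s′ (z ℤ.+ v)) → global c s z ≡ global c′ s′ z
  global-cong c c′ s s′ z c≈c′ s≈s′ = cong₂ f (map-fromList-cong V c≈c′) (map-fromList-cong V′ s≈s′)

  -- The states after t steps at finitely many cells depend on finitely many initial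
  -- states and random symbols.
  iterate-local : ∀ t (zs : List ℤ) → Σ[ cells ∈ List ℤ ] Σ[ sites ∈ List (Fin t × ℤ) ]
    ∀ {c c′ : Config} {s s′ : Vector (ℤ → R) t} →
    (∀ {z} → z ∈ cells → c z ≡ c′ z) → (∀ {i z} → (i , z) ∈ sites → s i z ≡ s′ i z) →
    ∀ {z} → z ∈ zs → iterate t c s z ≡ iterate t c′ s′ z
  iterate-local zero    zs = zs , [] , λ c≈c′ _ → c≈c′
  iterate-local (suc t) zs =
    let cells , sites , local = iterate-local t (cartesianProductWith ℤ._+_ zs V) in
    cells ,
    List.map (map₁ inject₁) sites ++ List.map (fromℕ t ,_) (cartesianProductWith ℤ._+_ zs V′) ,
    λ {c} {c′} {s} {s′} c≈c′ s≈s′ {z} z∈zs →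
      global-cong (iterate t c (init s)) (iterate t c′ (init s′)) (last s) (last s′) z
      (λ v∈V → local {s = init s} {init s′} c≈c′
        (λ x∈ → s≈s′ (∈-++⁺ˡ (∈-map⁺ (map₁ inject₁) x∈))) (∈-cartesianProductWith⁺ ℤ._+_ z∈zs v∈V))
      (λ v∈V′ → s≈s′ (∈-++⁺ʳ (List.map (map₁ inject₁) sites)
        (∈-map⁺ (fromℕ t ,_) (∈-cartesianProductWith⁺ ℤ._+_ z∈zs v∈V′))))

  iterate-cong : ∀ t {c} {s s′ : Vector (ℤ → R) t} → (∀ i z → s i z ≡ s′ i z) →
                 iterate t c s ≗ iterate t c s′
  iterate-cong t s≈s′ z =
    let cells , sites , local = iterate-local t (z ∷ []) in
    local (λ _ → refl) (λ {i} {z} _ → s≈s′ i z) (here refl)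

  -- The first step can be split off instead of the last.
  iterate-head : ∀ t c (s : Vector (ℤ → R) (suc t)) →
                 iterate t (global c (head s)) (tail s) ≗ iterate (suc t) c s
  iterate-head zero    c s z = refl
  iterate-head (suc t) c s z = global-cong
    (iterate t (global c (head s)) (init (tail s))) (iterate (suc t) c (init s)) (last s) (last s) z
    (λ _ → iterate-head t c (init s) _) (λ _ → refl)

  surjective-pred : ∀ t → Surjective F (suc t) → Surjective F t
  surjective-pred t surj c =
    let c₀ , s , F≗c = surj c in
    global c₀ (head s) , tail s , λ z → trans (iterate-head t c₀ s z) (F≗c z)

  module _ {q} (Q≡ : ∣Q∣ ≡ suc q) where

    0Q : Σ[ x ∈ Q ] toℕ x ≡ 0
    0Q = zero-of Q≡
      where
      zero-of : ∀ {n} → n ≡ suc q → Σ[ x ∈ Fin n ] toℕ x ≡ 0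
      zero-of refl = Fin.zero , refl

    -- The configuration c with all cells outside a finite list set to 0.
    truncate : ∀ (c : Config) (cells : List ℤ) →
               ∃[ c′ ] Finite F c′ × (∀ {z} → z ∈ cells → c′ z ≡ c z)
    truncate c cells = c′ , fin , agree
      where
      open DecMembership ℤ._≟_ using (_∈?_)
      c′ : Config
      c′ z with z ∈? cells
      ... | yes _ = c z
      ... | no  _ = proj₁ 0Q
      agree : ∀ {z} → z ∈ cells → c′ z ≡ c z
      agree {z} z∈ with z ∈? cells
      ... | yes _ = refl
      ... | no z∉ = contradiction z∈ z∉
      support : ∀ z → toℕ (c′ z) ≢ 0 → z ∈ cells
      support z nz with z ∈? cells
      ... | yes z∈ = z∈
      ... | no  _  = contradiction (proj₂ 0Q) nz
      fin : Finite F c′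
      fin = record
        { cells    = deduplicate ℤ._≟_ cells
        ; unique   = deduplicate-! cells
        ; complete = λ z nz → ∈-deduplicate⁺ ℤ._≟_ (support z nz)
        }

  -- If F^t is surjective, every neighbourhood pattern a appears around cell 0 after t
  -- steps from a finite configuration, for all random symbols in some cylinder.
  pattern-reachable : ∀ {q} → ∣Q∣ ≡ suc q → ∀ t → Surjective F t → (a : Vec Q (length V)) →
    Σ[ c ∈ Config ] Finite F c × (Σ[ s ∈ Vector (ℤ → R) t ] Σ[ sites ∈ List (Fin t × ℤ) ]
      ∀ {s′ : Vector (ℤ → R) t} →
      (∀ {i z} → (i , z) ∈ sites → s′ i z ≡ s i z) →
      Vec.map (λ v → iterate t c s′ (0ℤ ℤ.+ v)) (Vec.fromList V) ≡ a)
  pattern-reachable Q≡ t surj a =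
    let c⋆ , c⋆≡a = interpolate V V-unique (proj₁ (0Q Q≡)) a
        c₁ , s , F≗c⋆ = surj c⋆
        cells , sites , local = iterate-local t V
        c , fin , c≈c₁ = truncate Q≡ c₁ cells
    in c , fin , s , sites , λ {s′} s′≈s → trans
      (map-fromList-cong V (λ {v} v∈V → trans (cong (iterate t c s′) (ℤ.+-identityˡ v))
         (trans (local c≈c₁ s′≈s v∈V) (F≗c⋆ v))))
      c⋆≡a

-- The last step of a CFCA

-- The dependence of F^(t+1) on the random symbol u used by cell 0 in the last step,
-- all other random symbols being those of ω.
module LastStep (F : SCA) (cfca : CFCA F) (t : ℕ) (c : SCA.Config F)
                (ω : Fin (suc t) × ℤ → Fin (SCA.∣R∣ F)) where
  open SCA F using (∣R∣; R≢∅; Config; R; V; V′; f; iterate)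
  open NullSets ∣R∣ {{R≢∅}} (suc t) using (update; update-hit; update-miss)

  -- The site of the symbol that cell 0 uses in the last step.
  x₀ : Fin (suc t) × ℤ
  x₀ = fromℕ t , 0ℤ

  ω[_] : R → Vector (ℤ → R) (suc t)
  ω[ u ] = curry (update ω x₀ u)

  outcome : R → Config
  outcome u = iterate (suc t) c ω[ u ]

  init≡ω : ∀ u i z → init ω[ u ] i z ≡ ω (inject₁ i , z)
  init≡ω u i z = update-miss ω x₀ u (inject₁ i , z) λ eq → Fin.fromℕ≢inject₁ (sym (cong proj₁ eq))

  -- The only place where the CFCA hypothesis enters.
  V′-origin : ∀ {v} → v ∈ V′ → v ≡ 0ℤ
  V′-origin {v} v∈V′ with subst (v ∈_) cfca v∈V′
  ... | here v≡0 = v≡0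

  -- If a appears around cell 0 after t steps and ρ reads the random symbols b on V′,
  -- then with u = ρ 0 the final state of cell 0 is f a b.
  outcome-origin : ∀ {a b ρ} →
    Vec.map (λ v → iterate t c (init ω[ ρ 0ℤ ]) (0ℤ ℤ.+ v)) (Vec.fromList V) ≡ a →
    Vec.map ρ (Vec.fromList V′) ≡ b → outcome (ρ 0ℤ) 0ℤ ≡ f a b
  outcome-origin {ρ = ρ} ≡a ρ≡b = cong₂ f ≡a
    (trans (map-fromList-cong V′ λ v∈V′ → at-origin (V′-origin v∈V′)) ρ≡b)
    where
    at-origin : ∀ {v} → v ≡ 0ℤ → last ω[ ρ 0ℤ ] (0ℤ ℤ.+ v) ≡ ρ v
    at-origin refl = update-hit ω x₀ (ρ 0ℤ)

  outcome-elsewhere : ∀ u u′ {z} → z ≢ 0ℤ → outcome u z ≡ outcome u′ z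
  outcome-elsewhere u u′ {z} z≢0 =
    global-cong F (iterate t c (init ω[ u ])) (iterate t c (init ω[ u′ ])) (last ω[ u ]) (last ω[ u′ ]) z
      (λ {v} _ → iterate-cong F t (λ i y → trans (init≡ω u i y) (sym (init≡ω u′ i y))) (z ℤ.+ v))
      (λ v∈V′ → trans (last-miss u (V′-origin v∈V′)) (sym (last-miss u′ (V′-origin v∈V′))))
    where
    last-miss : ∀ u {v} → v ≡ 0ℤ → last ω[ u ] (z ℤ.+ v) ≡ ω (fromℕ t , z ℤ.+ v)
    last-miss u refl = update-miss ω x₀ u (fromℕ t , z ℤ.+ 0ℤ)
      λ eq → z≢0 (trans (sym (ℤ.+-identityʳ z)) (cong proj₂ eq))

some : ∀ n → {{NonZero n}} → Fin n
some (suc n) = Fin.zero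

theorem5p4 : (F : SCA) → CFCA F → (t : ℕ) → 0 < t →
    NumberConserving F t → Surjective F t → Deterministic F
theorem5p4 F cfca (suc t) _ ((q , Q≡) , conserves) surj a b b′ =
  let c , fin , s , sites , produces-a = pattern-reachable F Q≡ t (surjective-pred F t surj) a
      -- The value of r₀ is irrelevant: below it fills in ρ and ρ′ off V′, and the
      -- symbols of the last step in a point of which only earlier symbols matter.
      r₀ = some ∣R∣
      ρ , ρ≡b = interpolate V′ V′-unique r₀ b
      ρ′ , ρ′≡b′ = interpolate V′ V′-unique r₀ b′
      ω , agrees , typical = null-avoidable (proj₂ (conserves c fin)) (snoc s (const r₀))
                               (List.map (map₁ inject₁) sites) (fromℕ t , 0ℤ)
      open LastStep F cfca t c ω
      init≡s : ∀ u {i z} → (i , z) ∈ sites → init ω[ u ] i z ≡ s i z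
      init≡s u {i} {z} x∈ = trans (init≡ω u i z) (trans (agrees (∈-map⁺ (map₁ inject₁) x∈))
        (cong (λ h → h z) (snoc-inject₁ s (const r₀) i)))
      ends-in : ∀ {b} ρ → Vec.map ρ (Vec.fromList V′) ≡ b → outcome (ρ 0ℤ) 0ℤ ≡ f a b
      ends-in ρ ρ≡b = outcome-origin {ρ = ρ} (produces-a (init≡s (ρ 0ℤ))) ρ≡b
  in decidable-stable (f a b Fin.≟ f a b′) λ fab≢fab′ →
    typical (ρ 0ℤ) λ (fin₁ , total₁) → typical (ρ′ 0ℤ) λ (fin₂ , total₂) →
      fab≢fab′ (begin
        f a b               ≡⟨ ends-in ρ ρ≡b ⟨
        outcome (ρ 0ℤ) 0ℤ   ≡⟨ total-determines F fin₁ fin₂ 0ℤ (outcome-elsewhere (ρ 0ℤ) (ρ′ 0ℤ))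
                                 (trans total₁ (sym total₂)) ⟩
        outcome (ρ′ 0ℤ) 0ℤ  ≡⟨ ends-in ρ′ ρ′≡b′ ⟩
        f a b′              ∎)
  where
  open SCA F
  open NullSets ∣R∣ (suc t) using (null-avoidable)
  open ≡-Reasoning
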